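{- For every integer $n\geq 3$, writing $f_q(n)$ for the total number of occurrences of the pattern $q$ in all permutations of $S_n(123,132,231)$, we have $$f_{213}(n)=f_{312}(n)=\binom{n}{3},\qquad f_{321}(n)=(n-2)\binom{n}{3}.$$
   Context: $S_n$ is the set of permutations of $\{1,\dots,n\}$ written in one-line notation $\sigma=\sigma_1\sigma_2\cdots\sigma_n$. For $q\in S_k$, an occurrence of the pattern $q$ in $\sigma\in S_n$ is a choice of indices $i_1<i_2<\cdots<i_k$ in $\{1,\dots,n\}$ such that for all $1\le j,l\le k$, $q_j<q_l$ if and only if $\sigma_{i_j}<\sigma_{i_l}$. Let $f_q(\sigma)$ be the number of occurrences of $q$ in $\sigma$; $\sigma$ avoids $q$ if $f_q(\sigma)=0$. $S_n(123,132,231)$ is the set of permutations in $S_n$ avoiding all of $123$, $132$ and $231$, and $f_q(n)=\sum_{\sigma\in S_n(123,132,231)}f_q(\sigma)$. -}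

module Defs where

open import Data.Fin.Base using (Fin; _<_)
open import Data.Fin.Patterns using (0F; 1F; 2F)
open import Data.Fin.Properties using (_<?_; _≟_; all?)
open import Data.List.Base using (List; []; _∷_; allFin; cartesianProductWith; filter; length; map)
open import Data.List.Membership.Propositional using (_∈_)
open import Data.List.Membership.Propositional.Properties
  using (∈-allFin; ∈-cartesianProductWith⁺; ∈-filter⁺; ∈-filter⁻)
import Data.List.Relation.Unary.All as All
import Data.List.Relation.Unary.AllPairs as ListAllPairs
open import Data.List.Relation.Unary.Any using (here)
import Data.List.Relation.Unary.Unique.Propositional as List
open import Data.List.Relation.Unary.Unique.Propositional.Properties
  using (allFin⁺; cartesianProductWith⁺; filter⁺)
open import Data.Nat.Base using (ℕ; zero; suc)
open import Data.Nat.ListAction using (sum)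
import Data.Nat.Properties as ℕ
open import Data.Product.Base using (_×_; _,_; proj₂; uncurry)
open import Data.Vec.Base using (Vec; []; _∷_; lookup)
open import Data.Vec.Properties using (∷-injective)
open import Data.Vec.Relation.Unary.AllPairs using (allPairs?)
open import Data.Vec.Relation.Unary.Linked using (Linked; linked?)
open import Data.Vec.Relation.Unary.Unique.Propositional using (Unique)
open import Function.Bundles using (_⇔_; mk⇔; Equivalence)
open import Relation.Binary.PropositionalEquality using (_≡_; refl)
open import Relation.Nullary using (Dec)
open import Relation.Nullary.Decidable using (_×-dec_; _→-dec_; ¬?; map′)
open import Relation.Unary using (Decidable)

words : ∀ n k → List (Vec (Fin n) k)
words n zero    = [] ∷ []
words n (suc k) = cartesianProductWith _∷_ (allFin n) (words n k)

-- One-line notation with positions and values numbered from 0: a word of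
-- length n over the n-element alphabet Fin n is a permutation as soon as
-- its letters are pairwise distinct.

IsPermutation : ∀ {n} → Vec (Fin n) n → Set
IsPermutation = Unique

isPermutation? : ∀ {n} → Decidable (IsPermutation {n})
isPermutation? = allPairs? (λ x y → ¬? (x ≟ y))

S : ∀ n → List (Vec (Fin n) n)
S n = filter isPermutation? (words n n)

-- Both q and σ are meant to be permutations.

IsOccurrence : ∀ {k n} → Vec (Fin k) k → Vec (Fin n) n → Vec (Fin n) k → Set
IsOccurrence q σ i =
  Linked _<_ i ×
  (∀ j l → lookup q j < lookup q l ⇔ lookup σ (lookup i j) < lookup σ (lookup i l))

infix 3 _⇔-dec_
_⇔-dec_ : ∀ {A B : Set} → Dec A → Dec B → Dec (A ⇔ B)
a? ⇔-dec b? = map′ (uncurry mk⇔) (λ e → Equivalence.to e , Equivalence.from e)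
  ((a? →-dec b?) ×-dec (b? →-dec a?))

isOccurrence? : ∀ {k n} (q : Vec (Fin k) k) (σ : Vec (Fin n) n) → Decidable (IsOccurrence q σ)
isOccurrence? q σ i =
  linked? _<?_ i ×-dec
  all? λ j → all? λ l →
    (lookup q j <? lookup q l) ⇔-dec (lookup σ (lookup i j) <? lookup σ (lookup i l))

occurrences : ∀ {k n} → Vec (Fin k) k → Vec (Fin n) n → ℕ
occurrences {k} {n} q σ = length (filter (isOccurrence? q σ) (words n k))

Avoids : ∀ {k n} → Vec (Fin n) n → Vec (Fin k) k → Set
Avoids σ q = occurrences q σ ≡ 0

avoids? : ∀ {k n} (σ : Vec (Fin n) n) → Decidable (Avoids {k} σ)
avoids? σ q = occurrences q σ ℕ.≟ 0

-- The digits in a pattern's name are the usual ones, numbered from 1.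

p123 p132 p213 p231 p312 p321 : Vec (Fin 3) 3
p123 = 0F ∷ 1F ∷ 2F ∷ []
p132 = 0F ∷ 2F ∷ 1F ∷ []
p213 = 1F ∷ 0F ∷ 2F ∷ []
p231 = 1F ∷ 2F ∷ 0F ∷ []
p312 = 2F ∷ 0F ∷ 1F ∷ []
p321 = 2F ∷ 1F ∷ 0F ∷ []

S⟨123,132,231⟩ : ∀ n → List (Vec (Fin n) n)
S⟨123,132,231⟩ n =
  filter (λ σ → avoids? σ p123 ×-dec avoids? σ p132 ×-dec avoids? σ p231) (S n)

f : ∀ {k} → Vec (Fin k) k → ℕ → ℕ
f q n = sum (map (occurrences q) (S⟨123,132,231⟩ n))

-- The lists above enumerate each word, respectively each permutation,
-- exactly once, so their lengths and sums count what they should.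

∈-words : ∀ {n k} (w : Vec (Fin n) k) → w ∈ words n k
∈-words []      = here refl
∈-words (x ∷ w) = ∈-cartesianProductWith⁺ _∷_ (∈-allFin x) (∈-words w)

words-unique : ∀ n k → List.Unique (words n k)
words-unique n zero    = All.[] ListAllPairs.∷ ListAllPairs.[]
words-unique n (suc k) =
  cartesianProductWith⁺ _∷_ ∷-injective (allFin⁺ n) (words-unique n k)

∈-S⇔ : ∀ {n} (σ : Vec (Fin n) n) → σ ∈ S n ⇔ IsPermutation σ
∈-S⇔ {n} σ = mk⇔
  (λ σ∈S → proj₂ (∈-filter⁻ isPermutation? {xs = words n n} σ∈S))
  (∈-filter⁺ isPermutation? (∈-words σ))

S-unique : ∀ n → List.Unique (S n)
S-unique n = filter⁺ isPermutation? (words-unique n n)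

{-# OPTIONS --safe #-}
-- 123, 132 and 231 are the patterns of length 3 that begin with an ascent, so
-- the avoiders in S_n are the permutations whose first n - 1 letters decrease;
-- there is exactly one for each last letter k.  In it, an occurrence of 213 or
-- 312 must end at the last position, and sending it to its set of three values
-- is a bijection from all such occurrences, over all k, onto the 3-subsets of
-- the alphabet (k being the largest, respectively the middle, element).  The
-- remaining triples of positions are the occurrences of 321, so they number
-- n C(n,3) - 2 C(n,3).
module Submission where

open import Defs
open import Data.Fin.Base using (Fin; zero; suc; toℕ; fromℕ; opposite; _<_)
open import Data.Fin.Patterns using (0F; 1F; 2F)
open import Data.Fin.Permutation
  using (Permutation; _⟨$⟩ʳ_; _⟨$⟩ˡ_; _∘ₚ_; reverse; insert; insert-punchIn; inverseˡ; inverseʳ)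
  renaming (id to idₚ)
open import Data.Fin.Properties as Fin
  using (_≟_; _<?_; all?; <-cmp; <-trans; <-asym; <⇒≢; ≤∧≢⇒<; ≤fromℕ;
         opposite-prop; opposite-involutive; punchIn-cancel-≤)
open import Data.List.Base
  using (List; []; _∷_; _++_; allFin; cartesianProduct; filter; length; map)
open import Data.List.Membership.Propositional using (_∈_; lose)
open import Data.List.Membership.Propositional.Properties
  using (∈-allFin; ∈-filter⁺; ∈-filter⁻; ∈-map⁺; ∈-map⁻; ∈-++⁺ˡ; ∈-++⁺ʳ; ∈-++⁻;
         ∈-cartesianProduct⁺; ∈-cartesianProduct⁻)
open import Data.List.Membership.Propositional.Properties.WithK using (unique∧set⇒bag)
open import Data.List.Properties
  using (filter-++; filter-none; filter-some; length-++; length-map; length-tabulate; map-∘)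
open import Data.List.Relation.Binary.BagAndSetEquality using (∼bag⇒↭)
open import Data.List.Relation.Binary.Permutation.Propositional using (_↭_)
open import Data.List.Relation.Binary.Permutation.Propositional.Properties using (↭-length)
import Data.List.Relation.Binary.Permutation.Propositional.Properties as Perm
import Data.List.Relation.Unary.All as All
import Data.List.Relation.Unary.Unique.Propositional as List
import Data.List.Relation.Unary.Unique.Propositional.Properties as List
open import Data.Nat.Base as ℕ using (ℕ; zero; suc; _≤_; _∸_; _*_; _+_; z≤n; s≤s; s<s)
open import Data.Nat.Combinatorics using (_C_; nCk+nC[k+1]≡[n+1]C[k+1])
open import Data.Nat.ListAction using (sum)
open import Data.Nat.ListAction.Properties using (sum-↭)
import Data.Nat.Properties as ℕ
open import Data.Product.Base using (_×_; _,_; ∃; proj₁; proj₂; uncurry; <_,_>)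
open import Data.Sum.Base using (inj₁; inj₂)
open import Data.Vec.Base as Vec using (Vec; []; _∷_; lookup; tabulate)
open import Data.Vec.Properties
  using (∷-injectiveˡ; ∷-injectiveʳ; lookup-map; lookup∘tabulate; tabulate∘lookup; tabulate-cong)
open import Data.Vec.Relation.Unary.Linked as Linked using (Linked; [-]; _∷_; linked?)
import Data.Vec.Relation.Unary.Linked.Properties as Linked
import Data.Vec.Relation.Unary.Unique.Propositional.Properties as Vec
open import Function.Base using (_∘_; _$_)
open import Function.Bundles using (mk⇔; Equivalence)
open import Relation.Binary.Definitions using (tri<; tri≈; tri>)
open import Relation.Binary.PropositionalEquality
  using (_≡_; _≢_; refl; sym; trans; cong; cong₂; subst; subst₂; module ≡-Reasoning)
open import Relation.Nullary using (¬_; Dec; yes; no; contradiction)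
open import Relation.Nullary.Decidable using (_×-dec_; map′; from-yes)
open import Relation.Unary using (Decidable; _∪_)
open import Relation.Unary.Properties using (_∪?_)

private
  variable
    A B : Set
    m n r : ℕ

-- Counting in lists and vectors.

-- Without repetitions every multiplicity is 0 or 1, so membership alone decides bag equality. The
-- bijective counts below are obtained this way.
unique∧⇔⇒↭ : {xs ys : List A} → List.Unique xs → List.Unique ys →
             (∀ {x} → x ∈ xs → x ∈ ys) → (∀ {x} → x ∈ ys → x ∈ xs) → xs ↭ ys
unique∧⇔⇒↭ xs! ys! to from = ∼bag⇒↭ (unique∧set⇒bag xs! ys! (mk⇔ to from))

length-filter-∪ : {P Q : A → Set} (P? : Decidable P) (Q? : Decidable Q) →
                  (∀ {x} → P x → ¬ Q x) → ∀ xs →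
                  length (filter P? xs) + length (filter Q? xs) ≡ length (filter (P? ∪? Q?) xs)
length-filter-∪ P? Q? disj [] = refl
length-filter-∪ P? Q? disj (x ∷ xs) with P? x | Q? x
... | yes p | yes q = contradiction q (disj p)
... | yes p | no  _ = cong suc (length-filter-∪ P? Q? disj xs)
... | no  _ | yes q = trans (ℕ.+-suc _ _) (cong suc (length-filter-∪ P? Q? disj xs))
... | no  _ | no  _ = length-filter-∪ P? Q? disj xs

length-filter-map : {P : B → Set} (P? : Decidable P) (g : A → B) → ∀ xs →
                    length (filter P? (map g xs)) ≡ length (filter (P? ∘ g) xs)
length-filter-map P? g [] = refl
length-filter-map P? g (x ∷ xs) with P? (g x)
... | yes _ = cong suc (length-filter-map P? g xs)
... | no  _ = length-filter-map P? g xs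

-- Lets a sum of occurrence counts over permutations be read as a single count of pairs.
length-filter-cartesianProduct :
  {P : A × B → Set} (P? : Decidable P) → ∀ xs ys →
  length (filter P? (cartesianProduct xs ys)) ≡
  sum (map (λ x → length (filter (λ y → P? (x , y)) ys)) xs)
length-filter-cartesianProduct P? [] ys = refl
length-filter-cartesianProduct P? (x ∷ xs) ys = begin
  length (filter P? (map (x ,_) ys ++ cartesianProduct xs ys))
    ≡⟨ cong length (filter-++ P? (map (x ,_) ys) (cartesianProduct xs ys)) ⟩
  length (filter P? (map (x ,_) ys) ++ filter P? (cartesianProduct xs ys))
    ≡⟨ length-++ (filter P? (map (x ,_) ys)) ⟩
  length (filter P? (map (x ,_) ys)) + length (filter P? (cartesianProduct xs ys))
    ≡⟨ cong₂ _+_ (length-filter-map P? (x ,_) ys) (length-filter-cartesianProduct P? xs ys) ⟩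
  length (filter (λ y → P? (x , y)) ys) +
  sum (map (λ x → length (filter (λ y → P? (x , y)) ys)) xs) ∎
  where open ≡-Reasoning

length-cartesianProduct : (xs : List A) (ys : List B) →
                          length (cartesianProduct xs ys) ≡ length xs * length ys
length-cartesianProduct [] ys = refl
length-cartesianProduct (x ∷ xs) ys =
  trans (length-++ (map (x ,_) ys))
        (cong₂ _+_ (length-map (x ,_) ys) (length-cartesianProduct xs ys))

lookup-ext : {xs ys : Vec A n} → (∀ i → lookup xs i ≡ lookup ys i) → xs ≡ ys
lookup-ext {xs = xs} {ys} eq =
  trans (sym (tabulate∘lookup xs)) (trans (tabulate-cong eq) (tabulate∘lookup ys))

map-injective : {g : A → B} → (∀ {x y} → g x ≡ g y → x ≡ y) →
                {xs ys : Vec A n} → Vec.map g xs ≡ Vec.map g ys → xs ≡ ys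
map-injective g-inj {[]} {[]} eq = refl
map-injective g-inj {x ∷ xs} {y ∷ ys} eq =
  cong₂ _∷_ (g-inj (∷-injectiveˡ eq)) (map-injective g-inj (∷-injectiveʳ eq))

-- Increasing words and binomial coefficients.

increasing : ∀ n k → List (Vec (Fin n) k)
increasing n k = filter (linked? _<?_) (words n k)

increasing-unique : ∀ n k → List.Unique (increasing n k)
increasing-unique n k = List.filter⁺ (linked? _<?_) (words-unique n k)

∈-increasing⁺ : {w : Vec (Fin n) r} → Linked _<_ w → w ∈ increasing n r
∈-increasing⁺ {w = w} = ∈-filter⁺ (linked? _<?_) (∈-words w)

∈-increasing⁻ : {w : Vec (Fin n) r} → w ∈ increasing n r → Linked _<_ w
∈-increasing⁻ {n} {r} w∈ = proj₂ (∈-filter⁻ (linked? _<?_) {xs = words n r} w∈)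

map-suc⁺ : {w : Vec (Fin n) r} → Linked _<_ w → Linked _<_ (Vec.map suc w)
map-suc⁺ = Linked.map⁺ ∘ Linked.map s<s

map-suc⁻ : {w : Vec (Fin n) r} → Linked _<_ (Vec.map suc w) → Linked _<_ w
map-suc⁻ = Linked.map ℕ.s<s⁻¹ ∘ Linked.map⁻

0∷map-suc⁺ : {w : Vec (Fin n) r} → Linked _<_ w → Linked _<_ (zero ∷ Vec.map suc w)
0∷map-suc⁺ {w = []}    _ = [-]
0∷map-suc⁺ {w = _ ∷ _} p = ℕ.z<s ∷ map-suc⁺ p

unmap-suc : {x : Fin (suc n)} {w : Vec (Fin (suc n)) r} → Linked _<_ (x ∷ w) →
            ∃ λ v → w ≡ Vec.map suc v
unmap-suc [-] = [] , refl
-- A word `w` beginning with `zero` is impossible, as no letter lies below `zero`.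
unmap-suc {w = suc y ∷ w} (_ ∷ p) with unmap-suc p
... | v , refl = y ∷ v , refl

-- Pascal's rule, an increasing word standing for its set of letters: the first letter is `zero` or
-- it is not, and in both cases all letters after it are positive.
increasing-suc : ∀ n k → increasing (suc n) (suc k) ↭
  map (λ w → zero ∷ Vec.map suc w) (increasing n k) ++ map (Vec.map suc) (increasing n (suc k))
increasing-suc n k = unique∧⇔⇒↭ (increasing-unique _ _)
  (List.++⁺ (List.map⁺ (map-injective Fin.suc-injective ∘ ∷-injectiveʳ) (increasing-unique n k))
            (List.map⁺ (map-injective Fin.suc-injective) (increasing-unique n (suc k)))
            disjoint)
  (split ∘ ∈-increasing⁻) (∈-increasing⁺ ∘ join)
  where
  zeros sucs : List (Vec (Fin (suc n)) (suc k))
  zeros = map (λ w → zero ∷ Vec.map suc w) (increasing n k)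
  sucs  = map (Vec.map suc) (increasing n (suc k))

  disjoint : ∀ {w} → ¬ (w ∈ zeros × w ∈ sucs)
  disjoint (w∈ , w∈′) with ∈-map⁻ _ w∈ | ∈-map⁻ _ w∈′
  ... | _ , _ , refl | (_ ∷ _) , _ , ()

  split : ∀ {w} → Linked _<_ w → w ∈ zeros ++ sucs
  split {zero ∷ w} p with unmap-suc p
  ... | v , refl = ∈-++⁺ˡ (∈-map⁺ _ (∈-increasing⁺ (map-suc⁻ (Linked.tail p))))
  split {suc x ∷ w} p with unmap-suc p
  ... | v , refl = ∈-++⁺ʳ zeros (∈-map⁺ _ (∈-increasing⁺ (map-suc⁻ {w = x ∷ v} p)))

  join : ∀ {w} → w ∈ zeros ++ sucs → Linked _<_ w
  join w∈ with ∈-++⁻ zeros w∈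
  ... | inj₁ w∈₀ with ∈-map⁻ _ w∈₀
  ...   | v , v∈ , refl = 0∷map-suc⁺ (∈-increasing⁻ v∈)
  join w∈ | inj₂ w∈₁ with ∈-map⁻ _ w∈₁
  ...   | v , v∈ , refl = map-suc⁺ (∈-increasing⁻ v∈)

length-increasing : ∀ n k → length (increasing n k) ≡ n C k
length-increasing zero    zero    = refl
length-increasing (suc n) zero    = refl
length-increasing zero    (suc k) = refl
length-increasing (suc n) (suc k) = begin
  length (increasing (suc n) (suc k))
    ≡⟨ ↭-length (increasing-suc n k) ⟩
  length (map (λ w → zero ∷ Vec.map suc w) (increasing n k) ++
          map (Vec.map suc) (increasing n (suc k)))
    ≡⟨ length-++ (map (λ w → zero ∷ Vec.map suc w) (increasing n k)) ⟩
  length (map (λ w → zero ∷ Vec.map suc w) (increasing n k)) +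
  length (map (Vec.map suc) (increasing n (suc k)))
    ≡⟨ cong₂ _+_ (length-map _ (increasing n k)) (length-map _ (increasing n (suc k))) ⟩
  length (increasing n k) + length (increasing n (suc k))
    ≡⟨ cong₂ _+_ (length-increasing n k) (length-increasing n (suc k)) ⟩
  n C k + n C suc k
    ≡⟨ nCk+nC[k+1]≡[n+1]C[k+1] n k ⟩
  suc n C suc k ∎
  where open ≡-Reasoning

-- Strictly monotone maps.

opposite-anti : {i j : Fin n} → i < j → opposite j < opposite i
opposite-anti {n} {i} {j} i<j rewrite opposite-prop i | opposite-prop j =
  ℕ.∸-monoʳ-< (s<s i<j) (Fin.toℕ<n j)

StrictMono : (Fin m → Fin n) → Set
StrictMono g = ∀ {i j} → i < j → g i < g j

-- The codomain is `ℕ` so that the induction can pass to `ℕ.pred ∘ g ∘ suc`: the values of `g`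
-- beyond the first are positive, so taking predecessors keeps the map strictly monotone.
toℕ-strictMono : (g : Fin m → ℕ) → (∀ {i j} → i < j → g i ℕ.< g j) → ∀ i → toℕ i ≤ g i
toℕ-strictMono g mono zero    = z≤n
toℕ-strictMono g mono (suc i) =
  ℕ.≤-trans (s≤s (toℕ-strictMono (ℕ.pred ∘ g ∘ suc) mono′ i)) (ℕ.≤-reflexive (suc-pred i))
  where
  suc-pred : ∀ i → suc (ℕ.pred (g (suc i))) ≡ g (suc i)
  suc-pred i = ℕ.suc-pred (g (suc i)) {{ℕ.>-nonZero (ℕ.≤-<-trans z≤n (mono {zero} {suc i} ℕ.z<s))}}

  mono′ : ∀ {i j} → i < j → ℕ.pred (g (suc i)) ℕ.< ℕ.pred (g (suc j))
  mono′ {i} {j} i<j = ℕ.s<s⁻¹ (subst₂ ℕ._<_ (sym (suc-pred i)) (sym (suc-pred j)) (mono (s<s i<j)))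

strictMono⇒id : (g : Fin n → Fin n) → StrictMono g → ∀ i → g i ≡ i
strictMono⇒id g mono i with <-cmp (g i) i
... | tri≈ _ eq _ = eq
... | tri< gi<i _ _ = contradiction (toℕ-strictMono (toℕ ∘ g) mono i) (ℕ.<⇒≱ gi<i)
-- The upper bound on `g i` is the lower bound for the conjugate of `g` by `opposite`, taken at
-- `opposite i`.
... | tri> _ _ i<gi = contradiction
  (subst (λ x → toℕ (opposite i) ≤ toℕ (opposite (g x))) (opposite-involutive i)
    (toℕ-strictMono (toℕ ∘ opposite ∘ g ∘ opposite) (opposite-anti ∘ mono ∘ opposite-anti)
      (opposite i)))
  (ℕ.<⇒≱ (opposite-anti i<gi))

-- Permutations that decrease before the last position.

InitDecreasing : (Fin (suc m) → Fin (suc m)) → Set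
InitDecreasing {m} g = ∀ {i j} → i < j → j ≢ fromℕ m → g j < g i

-- `insert 0F k idₚ` sends `0F` to `k` and the other positions increasingly onto the other letters.
-- Reversing the positions first puts `k` last and the other letters before it in decreasing order.
arrange : Fin (suc m) → Permutation (suc m) (suc m)
arrange k = reverse ∘ₚ insert 0F k idₚ

arrange-last : (k : Fin (suc m)) → arrange k ⟨$⟩ʳ fromℕ m ≡ k
arrange-last k = cong (insert 0F k idₚ ⟨$⟩ʳ_) (opposite-involutive 0F)

arrange-initDecreasing : (k : Fin (suc m)) → InitDecreasing (arrange k ⟨$⟩ʳ_)
arrange-initDecreasing k {i} {j} i<j j≢last
  with opposite i in eqᵢ | opposite j in eqⱼ | opposite-anti i<j
-- `opposite j` is `zero` only at the last position.
... | suc a | zero  | _ = contradiction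
  (trans (sym (opposite-involutive j)) (cong opposite eqⱼ)) j≢last
-- On successors `insert 0F k idₚ` acts as `punchIn k`, which preserves strict order.
... | suc a | suc b | s≤s b<a =
  subst₂ _<_ (sym (insert-punchIn 0F k idₚ b)) (sym (insert-punchIn 0F k idₚ a))
    (ℕ.≰⇒> (ℕ.<⇒≱ b<a ∘ punchIn-cancel-≤ k a b))

module _ (k : Fin (suc m)) where
  private
    σ τ : Fin (suc m) → Fin (suc m)
    σ = arrange k ⟨$⟩ʳ_
    τ = arrange k ⟨$⟩ˡ_

  arrange⁻-last : τ k ≡ fromℕ m
  arrange⁻-last = trans (cong τ (sym (arrange-last k))) (inverseˡ (arrange k))

  arrange⁻-injective : ∀ {x y} → τ x ≡ τ y → x ≡ y
  arrange⁻-injective eq =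
    trans (sym (inverseʳ (arrange k))) (trans (cong σ eq) (inverseʳ (arrange k)))

  arrange⁻-≢last : ∀ {x} → x ≢ k → τ x ≢ fromℕ m
  arrange⁻-≢last x≢k eq = x≢k (arrange⁻-injective (trans eq (sym arrange⁻-last)))

  arrange⁻-<last : ∀ {x} → x ≢ k → τ x < τ k
  arrange⁻-<last x≢k =
    ≤∧≢⇒< (subst (λ j → toℕ (τ _) ≤ toℕ j) (sym arrange⁻-last) (≤fromℕ _))
      (x≢k ∘ arrange⁻-injective)

  arrange⁻-anti : ∀ {x y} → x < y → x ≢ k → y ≢ k → τ y < τ x
  arrange⁻-anti {x} {y} x<y x≢k y≢k with <-cmp (τ x) (τ y)
  ... | tri> _ _ lt = lt
  ... | tri≈ _ eq _ = contradiction (arrange⁻-injective eq) (<⇒≢ x<y)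
  ... | tri< lt _ _ = contradiction
    (subst₂ _<_ (inverseʳ (arrange k)) (inverseʳ (arrange k))
      (arrange-initDecreasing k lt (arrange⁻-≢last y≢k)))
    (<-asym x<y)

-- Composing with the inverse of the arrangement turns the decreasing part
-- into an increasing one, so the composite is the identity.
initDecreasing⇒arrange : {g : Fin (suc m) → Fin (suc m)} → (∀ {i j} → g i ≡ g j → i ≡ j) →
                         InitDecreasing g → ∀ i → g i ≡ arrange (g (fromℕ m)) ⟨$⟩ʳ i
initDecreasing⇒arrange {m} {g} g-inj dec i =
  trans (sym (inverseʳ (arrange k))) (cong (arrange k ⟨$⟩ʳ_) (strictMono⇒id _ mono i))
  where
  k : Fin (suc m)
  k = g (fromℕ m)

  mono : StrictMono (λ i → arrange k ⟨$⟩ˡ g i)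
  mono {i} {j} i<j with j ≟ fromℕ m
  -- At the last position `g` has the letter `k`, which the arrangement also puts after every other
  -- letter.
  ... | yes refl   = arrange⁻-<last k (<⇒≢ i<j ∘ g-inj)
  ... | no  j≢last = arrange⁻-anti k (dec i<j j≢last) (j≢last ∘ g-inj)
    (<⇒≢ (ℕ.<-≤-trans i<j (≤fromℕ j)) ∘ g-inj)

-- Occurrences described by their sorted values.

avoids⇒¬occurrence : (q : Vec (Fin r) r) (σ : Vec (Fin n) n) → Avoids σ q →
                     ∀ i → ¬ IsOccurrence q σ i
avoids⇒¬occurrence q σ none i occ =
  ℕ.<-irrefl (sym none) (filter-some (isOccurrence? q σ) (lose (∈-words i) occ))

¬occurrence⇒avoids : (q : Vec (Fin r) r) (σ : Vec (Fin n) n) →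
                     (∀ i → ¬ IsOccurrence q σ i) → Avoids σ q
¬occurrence⇒avoids q σ none =
  cong length (filter-none (isOccurrence? q σ) (All.universal none (words _ _)))

record AreInverse (q q⁻ : Vec (Fin r) r) : Set where
  constructor areInverse
  field
    q∘q⁻ : ∀ j → lookup q (lookup q⁻ j) ≡ j
    q⁻∘q : ∀ j → lookup q⁻ (lookup q j) ≡ j

open AreInverse

areInverse? : (q q⁻ : Vec (Fin r) r) → Dec (AreInverse q q⁻)
areInverse? q q⁻ = map′ (uncurry areInverse) < q∘q⁻ , q⁻∘q >
  (all? (λ j → lookup q (lookup q⁻ j) ≟ j) ×-dec all? (λ j → lookup q⁻ (lookup q j) ≟ j))

-- For q⁻ inverse to q, the values of an occurrence of q in increasing order.
sortedValues : Vec (Fin r) r → Vec (Fin n) n → Vec (Fin n) r → Vec (Fin n) r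
sortedValues q⁻ σ i = Vec.map (λ j → lookup σ (lookup i j)) q⁻

lookup-sortedValues : {q q⁻ : Vec (Fin r) r} → AreInverse q q⁻ →
                      (σ : Vec (Fin n) n) (i : Vec (Fin n) r) → ∀ j →
                      lookup (sortedValues q⁻ σ i) (lookup q j) ≡ lookup σ (lookup i j)
lookup-sortedValues {q = q} {q⁻} inv σ i j =
  trans (lookup-map (lookup q j) _ q⁻) (cong (λ x → lookup σ (lookup i x)) (q⁻∘q inv j))

-- Reduces an occurrence to inequalities between neighbours. Transitivity along the sorted values
-- carries every inequality of `q` over to `σ`; the converse follows by trichotomy, since equality
-- or the opposite order in `q` would be carried over too.
occurrence⁺ : {q q⁻ : Vec (Fin r) r} → AreInverse q q⁻ →
              (σ : Vec (Fin n) n) {i : Vec (Fin n) r} →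
              Linked _<_ i → Linked _<_ (sortedValues q⁻ σ i) → IsOccurrence q σ i
occurrence⁺ {q = q} {q⁻} inv σ {i} i↑ v↑ = i↑ , λ j l → mk⇔ (to j l) (from j l)
  where
  to : ∀ j l → lookup q j < lookup q l → lookup σ (lookup i j) < lookup σ (lookup i l)
  to j l lt = subst₂ _<_ (lookup-sortedValues inv σ i j) (lookup-sortedValues inv σ i l)
    (Linked.lookup⁺ <-trans v↑ lt)

  from : ∀ j l → lookup σ (lookup i j) < lookup σ (lookup i l) → lookup q j < lookup q l
  from j l lt with <-cmp (lookup q j) (lookup q l)
  ... | tri< lt′ _ _ = lt′
  ... | tri> _ _ gt = contradiction lt (<-asym (to l j gt))
  ... | tri≈ _ eq _ = contradiction
    (trans (sym (lookup-sortedValues inv σ i j))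
      (trans (cong (lookup (sortedValues q⁻ σ i)) eq) (lookup-sortedValues inv σ i l)))
    (<⇒≢ lt)

occurrence⁻ : {q q⁻ : Vec (Fin 3) 3} → AreInverse q q⁻ →
              (σ : Vec (Fin n) n) {i : Vec (Fin n) 3} →
              IsOccurrence q σ i → Linked _<_ (sortedValues q⁻ σ i)
occurrence⁻ {q⁻ = a ∷ b ∷ c ∷ []} inv σ (_ , e) =
  -- `a`, `b`, `c` are the positions at which `q` has the letters `0F`, `1F`, `2F`.
  Equivalence.to (e a b) (subst₂ _<_ (sym (q∘q⁻ inv 0F)) (sym (q∘q⁻ inv 1F)) ℕ.z<s) ∷
  Equivalence.to (e b c) (subst₂ _<_ (sym (q∘q⁻ inv 1F)) (sym (q∘q⁻ inv 2F)) (s<s ℕ.z<s)) ∷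
  [-]

-- The avoiders, one for each last letter.

-- An ascent at `i < j`, extended by the last position, would be an occurrence of a pattern that
-- begins with an ascent; the rank of the last value among the three decides which one.
avoids⇒initDecreasing : (σ : Vec (Fin (suc m)) (suc m)) → IsPermutation σ →
                        Avoids σ p123 → Avoids σ p132 → Avoids σ p231 →
                        InitDecreasing (lookup σ)
avoids⇒initDecreasing {m} σ σ! a123 a132 a231 {i} {j} i<j j≢last =
  cases (<-cmp (lookup σ i) (lookup σ j))
        (<-cmp (lookup σ j) (lookup σ l)) (<-cmp (lookup σ i) (lookup σ l))
  where
  l = fromℕ m
  j<l : j < l
  j<l = ≤∧≢⇒< (≤fromℕ j) j≢last

  inj : ∀ {x y} → lookup σ x ≡ lookup σ y → x ≡ y
  inj = Vec.lookup-injective σ! _ _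

  i↑ : Linked _<_ (i ∷ j ∷ l ∷ [])
  i↑ = i<j ∷ j<l ∷ [-]

  cases : _ → _ → _ → lookup σ j < lookup σ i
  cases (tri> _ _ gt) _ _ = gt
  cases (tri≈ _ eq _) _ _ = contradiction (inj eq) (<⇒≢ i<j)
  cases (tri< _ _ _) (tri≈ _ eq _) _ = contradiction (inj eq) (<⇒≢ j<l)
  cases (tri< _ _ _) _ (tri≈ _ eq _) = contradiction (inj eq) (<⇒≢ (<-trans i<j j<l))
  cases (tri< ij _ _) (tri< jl _ _) _ = contradiction
    (occurrence⁺ (from-yes (areInverse? p123 p123)) σ i↑ (ij ∷ jl ∷ [-]))
    (avoids⇒¬occurrence p123 σ a123 _)
  cases (tri< ij _ _) (tri> _ _ lj) (tri< il _ _) = contradiction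
    (occurrence⁺ (from-yes (areInverse? p132 p132)) σ i↑ (il ∷ lj ∷ [-]))
    (avoids⇒¬occurrence p132 σ a132 _)
  -- Unlike the two patterns before, 231 is not an involution: its inverse 312 lists the positions
  -- `l`, `i`, `j` by increasing value.
  cases (tri< ij _ _) (tri> _ _ lj) (tri> _ _ li) = contradiction
    (occurrence⁺ (from-yes (areInverse? p231 p312)) σ i↑ (li ∷ ij ∷ [-]))
    (avoids⇒¬occurrence p231 σ a231 _)

-- The second of three positions is never the last one, so the first two chosen letters descend.
initDecreasing⇒avoids : (σ : Vec (Fin (suc m)) (suc m)) → InitDecreasing (lookup σ) →
                        (q : Vec (Fin 3) 3) → lookup q 0F < lookup q 1F → Avoids σ q
initDecreasing⇒avoids σ dec q q₀<q₁ = ¬occurrence⇒avoids q σ λ where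
  (i ∷ j ∷ l ∷ []) (i<j ∷ j<l ∷ [-] , e) →
    <-asym (Equivalence.to (e 0F 1F) q₀<q₁) (dec i<j (<⇒≢ (ℕ.<-≤-trans j<l (≤fromℕ l))))

word : Fin (suc m) → Vec (Fin (suc m)) (suc m)
word k = tabulate (arrange k ⟨$⟩ʳ_)

lookup-word : (k i : Fin (suc m)) → lookup (word k) i ≡ arrange k ⟨$⟩ʳ i
lookup-word k = lookup∘tabulate (arrange k ⟨$⟩ʳ_)

word-injective : {k l : Fin (suc m)} → word k ≡ word l → k ≡ l
word-injective {m} {k} {l} eq =
  trans (sym (last k)) (trans (cong (λ w → lookup w (fromℕ m)) eq) (last l))
  where
  last : ∀ k → lookup (word k) (fromℕ m) ≡ k
  last k = trans (lookup-word k (fromℕ _)) (arrange-last k)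

word-initDecreasing : (k : Fin (suc m)) → InitDecreasing (lookup (word k))
word-initDecreasing k {i} {j} i<j j≢last =
  subst₂ _<_ (sym (lookup-word k j)) (sym (lookup-word k i)) (arrange-initDecreasing k i<j j≢last)

word-isPermutation : (k : Fin (suc m)) → IsPermutation (word k)
word-isPermutation k = Vec.tabulate⁺ λ eq →
  trans (sym (inverseˡ (arrange k))) (trans (cong (arrange k ⟨$⟩ˡ_) eq) (inverseˡ (arrange k)))

Avoider : Vec (Fin n) n → Set
Avoider σ = Avoids σ p123 × Avoids σ p132 × Avoids σ p231

avoider? : Decidable (Avoider {n})
avoider? σ = avoids? σ p123 ×-dec avoids? σ p132 ×-dec avoids? σ p231

avoider⇒word : {σ : Vec (Fin (suc m)) (suc m)} → IsPermutation σ → Avoider σ →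
               σ ≡ word (lookup σ (fromℕ m))
avoider⇒word {σ = σ} σ! (a123 , a132 , a231) = lookup-ext λ i → trans
  (initDecreasing⇒arrange (Vec.lookup-injective σ! _ _)
    (avoids⇒initDecreasing σ σ! a123 a132 a231) i)
  (sym (lookup-word _ i))

word-avoider : (k : Fin (suc m)) → Avoider (word k)
word-avoider k =
  initDecreasing⇒avoids (word k) (word-initDecreasing k) p123 ℕ.z<s ,
  initDecreasing⇒avoids (word k) (word-initDecreasing k) p132 ℕ.z<s ,
  initDecreasing⇒avoids (word k) (word-initDecreasing k) p231 (s<s ℕ.z<s)

-- The right-hand list has no repetitions because `k` can be recovered as the last letter of
-- `word k`.
avoiders : ∀ m → S⟨123,132,231⟩ (suc m) ↭ map word (allFin (suc m))
avoiders m = unique∧⇔⇒↭ (List.filter⁺ avoider? (S-unique (suc m)))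
  (List.map⁺ word-injective (List.allFin⁺ (suc m))) to from
  where
  to : ∀ {σ} → σ ∈ S⟨123,132,231⟩ (suc m) → σ ∈ map word (allFin (suc m))
  to {σ} σ∈ =
    let σ∈S , avoids = ∈-filter⁻ avoider? {xs = S (suc m)} σ∈
    in subst (_∈ map word (allFin (suc m)))
         (sym (avoider⇒word (Equivalence.to (∈-S⇔ σ) σ∈S) avoids)) (∈-map⁺ word (∈-allFin _))

  from : ∀ {σ} → σ ∈ map word (allFin (suc m)) → σ ∈ S⟨123,132,231⟩ (suc m)
  from σ∈ =
    let k , _ , σ≡ = ∈-map⁻ word σ∈
    in subst (_∈ S⟨123,132,231⟩ (suc m)) (sym σ≡)
         (∈-filter⁺ avoider? (Equivalence.from (∈-S⇔ (word k)) (word-isPermutation k))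
           (word-avoider k))

-- Occurrences in all avoiders at once.

-- A pair (k , i) stands for the positions i in word k.
Marked : ℕ → Set
Marked m = Fin (suc m) × Vec (Fin (suc m)) 3

allMarked : ∀ m → List (Marked m)
allMarked m = cartesianProduct (allFin (suc m)) (words (suc m) 3)

∈-allMarked : (x : Marked m) → x ∈ allMarked m
∈-allMarked (k , i) = ∈-cartesianProduct⁺ (∈-allFin k) (∈-words i)

allMarked-unique : ∀ m → List.Unique (allMarked m)
allMarked-unique m = List.cartesianProduct⁺ (List.allFin⁺ (suc m)) (words-unique (suc m) 3)

Occurs : Vec (Fin 3) 3 → Marked m → Set
Occurs q (k , i) = IsOccurrence q (word k) i

occurs? : (q : Vec (Fin 3) 3) → Decidable (Occurs {m} q)
occurs? q (k , i) = isOccurrence? q (word k) i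

-- Collecting all avoiders into one list is essential: the bijection with increasing triples of
-- letters lets `k` vary with the triple.
f≡length : ∀ q m → f q (suc m) ≡ length (filter (occurs? q) (allMarked m))
f≡length q m = begin
  sum (map (occurrences q) (S⟨123,132,231⟩ (suc m)))
    ≡⟨ sum-↭ (Perm.map⁺ (occurrences q) (avoiders m)) ⟩
  sum (map (occurrences q) (map word (allFin (suc m))))
    ≡⟨ cong sum (map-∘ (allFin (suc m))) ⟨
  sum (map (occurrences q ∘ word) (allFin (suc m)))
    ≡⟨ length-filter-cartesianProduct (occurs? q) (allFin (suc m)) (words (suc m) 3) ⟨
  length (filter (occurs? q) (allMarked m)) ∎
  where open ≡-Reasoning

-- The patterns 213 and 312.

-- The inequalities on q say that its last two letters form an ascent, which
-- forces the last letter of an occurrence onto the last position.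
module _ {q q⁻ : Vec (Fin 3) 3} (inv : AreInverse q q⁻)
         (q₁<q₀ : lookup q 1F < lookup q 0F) (q₁<q₂ : lookup q 1F < lookup q 2F) where
  private
    -- Inverse to `values` on occurrences. The value with the rank of the last letter of `q` has to
    -- be the last letter of the word, which determines `k`; the inverse arrangement then locates
    -- all three values.
    place : Vec (Fin (suc m)) 3 → Marked m
    place v = k , Vec.map (λ a → arrange k ⟨$⟩ˡ lookup v a) q
      where k = lookup v (lookup q 2F)

    values : Marked m → Vec (Fin (suc m)) 3
    values (k , i) = sortedValues q⁻ (word k) i

    q₀≢q₂ : lookup q 0F ≢ lookup q 2F
    q₀≢q₂ eq with trans (sym (q⁻∘q inv 0F)) (trans (cong (lookup q⁻) eq) (q⁻∘q inv 2F))
    ... | ()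

    values∘place : (v : Vec (Fin (suc m)) 3) → values (place v) ≡ v
    values∘place {m} v = lookup-ext λ a → begin
      lookup (values (place v)) a
        ≡⟨ lookup-map a _ q⁻ ⟩
      lookup (word k) (lookup i (lookup q⁻ a))
        ≡⟨ lookup-word k (lookup i (lookup q⁻ a)) ⟩
      arrange k ⟨$⟩ʳ lookup i (lookup q⁻ a)
        ≡⟨ cong (arrange k ⟨$⟩ʳ_) (lookup-map (lookup q⁻ a) _ q) ⟩
      arrange k ⟨$⟩ʳ (arrange k ⟨$⟩ˡ lookup v (lookup q (lookup q⁻ a)))
        ≡⟨ inverseʳ (arrange k) ⟩
      lookup v (lookup q (lookup q⁻ a))
        ≡⟨ cong (lookup v) (q∘q⁻ inv a) ⟩
      lookup v a ∎
      where
      open ≡-Reasoning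
      k = proj₁ (place v)
      i = proj₂ (place v)

    -- The third value is `k`, which stands last. The other two differ from `k` and so stand in
    -- decreasing order, which by `q₁<q₀` is the order that `q` prescribes.
    place-occurs : {v : Vec (Fin (suc m)) 3} → Linked _<_ v → Occurs q (place v)
    place-occurs {m} {v} v↑ =
      occurrence⁺ inv (word k) i↑ (subst (Linked _<_) (sym (values∘place v)) v↑)
      where
      k = proj₁ (place v)

      mono : ∀ {a b} → a < b → lookup v a < lookup v b
      mono = Linked.lookup⁺ <-trans v↑

      v₀≢v₂ : lookup v (lookup q 0F) ≢ lookup v (lookup q 2F)
      v₀≢v₂ eq with <-cmp (lookup q 0F) (lookup q 2F)
      ... | tri< lt _ _ = <⇒≢ (mono lt) eq
      ... | tri≈ _ e  _ = q₀≢q₂ e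
      ... | tri> _ _ gt = <⇒≢ (mono gt) (sym eq)

      -- Stated for an arbitrary `p` so that matching on its entries lets `Vec.map` compute.
      linked : (p : Vec (Fin 3) 3) (let k = lookup v (lookup p 2F)) →
        lookup v (lookup p 1F) < lookup v (lookup p 0F) →
        lookup v (lookup p 0F) ≢ k → lookup v (lookup p 1F) ≢ k →
        Linked _<_ (Vec.map (λ a → arrange k ⟨$⟩ˡ lookup v a) p)
      linked (x ∷ y ∷ z ∷ []) lt x≢z y≢z =
        arrange⁻-anti _ lt y≢z x≢z ∷ arrange⁻-<last _ y≢z ∷ [-]

      i↑ : Linked _<_ (proj₂ (place v))
      i↑ = linked q (mono q₁<q₀) v₀≢v₂ (<⇒≢ (mono q₁<q₂))

    occurs⇒place : {x : Marked m} → Occurs q x → place (values x) ≡ x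
    occurs⇒place {m} {k , i} (i↑ , e) = cong₂ _,_ k≡ i≡
      where
      v = values (k , i)

      v∘q : ∀ j → lookup v (lookup q j) ≡ arrange k ⟨$⟩ʳ lookup i j
      v∘q j = trans (lookup-sortedValues inv (word k) i j) (lookup-word k (lookup i j))

      ends-last : lookup i 2F ≡ fromℕ m
      ends-last with lookup i 2F ≟ fromℕ m
      ... | yes eq = eq
      -- Otherwise the word descends between the last two chosen positions, while `q` ascends there.
      ... | no ≢last = contradiction
        (word-initDecreasing k (Linked.lookup⁺ <-trans {i = 1F} {j = 2F} i↑ (s<s ℕ.z<s)) ≢last)
        (<-asym (Equivalence.to (e 1F 2F) q₁<q₂))

      k≡ : lookup v (lookup q 2F) ≡ k
      k≡ = trans (v∘q 2F) (trans (cong (arrange k ⟨$⟩ʳ_) ends-last) (arrange-last k))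

      i≡ : proj₂ (place v) ≡ i
      i≡ = lookup-ext λ j → begin
        lookup (proj₂ (place v)) j
          ≡⟨ lookup-map j _ q ⟩
        arrange (lookup v (lookup q 2F)) ⟨$⟩ˡ lookup v (lookup q j)
          ≡⟨ cong₂ (λ l x → arrange l ⟨$⟩ˡ x) k≡ (v∘q j) ⟩
        arrange k ⟨$⟩ˡ (arrange k ⟨$⟩ʳ lookup i j)
          ≡⟨ inverseˡ (arrange k) ⟩
        lookup i j ∎
        where open ≡-Reasoning

  -- `values∘place` makes `place` injective on increasing triples, and `occurs⇒place` makes it reach
  -- every occurrence.
  f≡nC3 : ∀ m → f q (suc m) ≡ suc m C 3
  f≡nC3 m = begin
    f q (suc m)                                  ≡⟨ f≡length q m ⟩
    length (filter (occurs? q) (allMarked m))    ≡⟨ ↭-length bij ⟩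
    length (map place (increasing (suc m) 3))    ≡⟨ length-map place (increasing (suc m) 3) ⟩
    length (increasing (suc m) 3)                ≡⟨ length-increasing (suc m) 3 ⟩
    suc m C 3                                    ∎
    where
    open ≡-Reasoning

    to : ∀ {x} → x ∈ filter (occurs? q) (allMarked m) → x ∈ map place (increasing (suc m) 3)
    to x∈ =
      let _ , occ = ∈-filter⁻ (occurs? q) {xs = allMarked m} x∈
      in subst (_∈ map place (increasing (suc m) 3)) (occurs⇒place occ)
           (∈-map⁺ place (∈-increasing⁺ (occurrence⁻ inv (word _) occ)))

    from : ∀ {x} → x ∈ map place (increasing (suc m) 3) → x ∈ filter (occurs? q) (allMarked m)
    from x∈ =
      let v , v∈ , x≡ = ∈-map⁻ place x∈
      in subst (_∈ filter (occurs? q) (allMarked m)) (sym x≡)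
           (∈-filter⁺ (occurs? q) (∈-allMarked (place v)) (place-occurs (∈-increasing⁻ v∈)))

    bij : filter (occurs? q) (allMarked m) ↭ map place (increasing (suc m) 3)
    bij = unique∧⇔⇒↭ (List.filter⁺ (occurs? q) (allMarked-unique m))
      (List.map⁺ (λ {v} {w} eq →
         trans (sym (values∘place v)) (trans (cong values eq) (values∘place w)))
       (increasing-unique (suc m) 3))
      to from

-- The pattern 321, by complement.

-- Both patterns end with an ascent, which in `word k` only the last position can complete; hence
-- the name.
Terminal : Marked m → Set
Terminal = Occurs p213 ∪ Occurs p312

terminal? : Decidable (Terminal {m})
terminal? = occurs? p213 ∪? occurs? p312

¬213∧312 : {x : Marked m} → Occurs p213 x → ¬ Occurs p312 x
¬213∧312 (_ , e) (_ , e′) =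
  <-asym (Equivalence.to (e 0F 2F) (s<s ℕ.z<s)) (Equivalence.to (e′ 2F 0F) (s<s ℕ.z<s))

¬terminal∧321 : {x : Marked m} → Terminal x → ¬ Occurs p321 x
¬terminal∧321 (inj₁ (_ , e)) (_ , e′) =
  <-asym (Equivalence.to (e 0F 2F) (s<s ℕ.z<s)) (Equivalence.to (e′ 2F 0F) ℕ.z<s)
¬terminal∧321 (inj₂ (_ , e)) (_ , e′) =
  <-asym (Equivalence.to (e 1F 2F) ℕ.z<s) (Equivalence.to (e′ 2F 1F) ℕ.z<s)

-- The first two letters always descend, so only the rank of the third is open: top gives 213,
-- middle 312, bottom 321.
triple-classification : (k : Fin (suc m)) {i : Vec (Fin (suc m)) 3} → Linked _<_ i →
                        (Terminal ∪ Occurs p321) (k , i)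
triple-classification {m} k {a ∷ b ∷ c ∷ []} i↑@(a<b ∷ b<c ∷ [-]) =
  cases (<-cmp (σ a) (σ c)) (<-cmp (σ b) (σ c))
  where
  σ = lookup (word k)

  inj : ∀ {x y} → σ x ≡ σ y → x ≡ y
  inj = Vec.lookup-injective (word-isPermutation k) _ _

  σb<σa : σ b < σ a
  σb<σa = word-initDecreasing k a<b (<⇒≢ (ℕ.<-≤-trans b<c (≤fromℕ c)))

  cases : _ → _ → (Terminal ∪ Occurs p321) (k , a ∷ b ∷ c ∷ [])
  cases (tri≈ _ eq _) _ = contradiction (inj eq) (<⇒≢ (<-trans a<b b<c))
  cases _ (tri≈ _ eq _) = contradiction (inj eq) (<⇒≢ b<c)
  cases (tri< ac _ _) _ = inj₁ $ inj₁ $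
    occurrence⁺ (from-yes (areInverse? p213 p213)) (word k) i↑ (σb<σa ∷ ac ∷ [-])
  cases (tri> _ _ ca) (tri< bc _ _) = inj₁ $ inj₂ $
    occurrence⁺ (from-yes (areInverse? p312 p231)) (word k) i↑ (bc ∷ ca ∷ [-])
  cases (tri> _ _ ca) (tri> _ _ cb) = inj₂ $
    occurrence⁺ (from-yes (areInverse? p321 p321)) (word k) i↑ (cb ∷ σb<σa ∷ [-])

-- The three patterns exclude one another and cover every increasing triple of positions, so each
-- such triple is counted once in each of the `suc m` words.
f213+f312+f321 : ∀ m →
  (f p213 (suc m) + f p312 (suc m)) + f p321 (suc m) ≡ suc m * (suc m C 3)
f213+f312+f321 m = begin
  (f p213 (suc m) + f p312 (suc m)) + f p321 (suc m)
    ≡⟨ cong₂ _+_ (cong₂ _+_ (f≡length p213 m) (f≡length p312 m)) (f≡length p321 m) ⟩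
  (length (filter (occurs? p213) (allMarked m)) + length (filter (occurs? p312) (allMarked m))) +
  length (filter (occurs? p321) (allMarked m))
    ≡⟨ cong (_+ length (filter (occurs? p321) (allMarked m)))
         (length-filter-∪ (occurs? p213) (occurs? p312) ¬213∧312 (allMarked m)) ⟩
  length (filter terminal? (allMarked m)) + length (filter (occurs? p321) (allMarked m))
    ≡⟨ length-filter-∪ terminal? (occurs? p321) ¬terminal∧321 (allMarked m) ⟩
  length (filter any? (allMarked m))
    ≡⟨ ↭-length all-triples ⟩
  length (cartesianProduct (allFin (suc m)) (increasing (suc m) 3))
    ≡⟨ length-cartesianProduct (allFin (suc m)) (increasing (suc m) 3) ⟩
  length (allFin (suc m)) * length (increasing (suc m) 3)
    ≡⟨ cong₂ _*_ (length-tabulate {n = suc m} (λ i → i)) (length-increasing (suc m) 3) ⟩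
  suc m * (suc m C 3) ∎
  where
  open ≡-Reasoning

  any? : Decidable (Terminal {m} ∪ Occurs p321)
  any? = terminal? ∪? occurs? p321

  increasing-positions : ∀ {x} → (Terminal {m} ∪ Occurs p321) x → Linked _<_ (proj₂ x)
  increasing-positions (inj₁ (inj₁ (i↑ , _))) = i↑
  increasing-positions (inj₁ (inj₂ (i↑ , _))) = i↑
  increasing-positions (inj₂ (i↑ , _))        = i↑

  to : ∀ {x} → x ∈ filter any? (allMarked m) →
       x ∈ cartesianProduct (allFin (suc m)) (increasing (suc m) 3)
  to x∈ =
    let _ , occ = ∈-filter⁻ any? {xs = allMarked m} x∈
    in ∈-cartesianProduct⁺ (∈-allFin _) (∈-increasing⁺ (increasing-positions occ))

  from : ∀ {x} → x ∈ cartesianProduct (allFin (suc m)) (increasing (suc m) 3) →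
         x ∈ filter any? (allMarked m)
  from {k , i} x∈ = ∈-filter⁺ any? (∈-allMarked _) $ triple-classification k $ ∈-increasing⁻ $
    proj₂ (∈-cartesianProduct⁻ (allFin (suc m)) (increasing (suc m) 3) x∈)

  all-triples : filter any? (allMarked m) ↭
                cartesianProduct (allFin (suc m)) (increasing (suc m) 3)
  all-triples = unique∧⇔⇒↭ (List.filter⁺ any? (allMarked-unique m))
    (List.cartesianProduct⁺ (List.allFin⁺ (suc m)) (increasing-unique (suc m) 3)) to from

theorem3p5 : (n : ℕ) → 3 ≤ n →
    (f p213 n ≡ f p312 n) × (f p312 n ≡ n C 3) × (f p321 n ≡ (n ∸ 2) * (n C 3))
theorem3p5 n@(suc m) _ = trans f213 (sym f312) , f312 , (begin
  f p321 n
    -- As `∸` truncates, `2 * c` is first added, so that subtracting it again is exact.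
    ≡⟨ ℕ.m+n∸m≡n (2 * c) (f p321 n) ⟨
  (2 * c + f p321 n) ∸ 2 * c
    -- `2 * c` unfolds to `c + (c + 0)`.
    ≡⟨ cong (λ x → (c + x + f p321 n) ∸ 2 * c) (ℕ.+-identityʳ c) ⟩
  (c + c + f p321 n) ∸ 2 * c
    ≡⟨ cong₂ (λ x y → (x + y + f p321 n) ∸ 2 * c) f213 f312 ⟨
  (f p213 n + f p312 n + f p321 n) ∸ 2 * c
    ≡⟨ cong (_∸ 2 * c) (f213+f312+f321 m) ⟩
  n * c ∸ 2 * c
    ≡⟨ ℕ.*-distribʳ-∸ c n 2 ⟨
  (n ∸ 2) * c ∎)
  where
  open ≡-Reasoning
  c = n C 3

  f213 : f p213 n ≡ c
  f213 = f≡nC3 (from-yes (areInverse? p213 p213)) ℕ.z<s ℕ.z<s m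

  f312 : f p312 n ≡ c
  f312 = f≡nC3 (from-yes (areInverse? p312 p231)) ℕ.z<s ℕ.z<s m
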